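{- Let $\mathcal{C}$ be the collection of all classes over the feature set $\mathcal{N}=\{\textit{top\_symbol},\textit{has\_symbol}\}$, with equality of classes understood as equality of semantic representations at every feature. Let $\wedge$ and $\vee$ be the featurewise meet and join of classes, let $\top$ be the most general class and let $\bot$ be the empty class. Then $(\mathcal{C},\vee,\wedge,\top,\bot)$ is a bounded lattice, with $C\vee\bot=C$ and $C\wedge\top=C$ for every class $C$.
   Context: Let $\mathcal{N}=\{\textit{top\_symbol},\textit{has\_symbol}\}$ be the set of feature names. A datum is an atomic piece of data (here, a symbol). A class $C$ assigns to each feature $f\in\mathcal{N}$ a value $C(f)$. This value is either a finite list of finite lists of data, or one of two special values $\top_f$ (most general) and $\bot_f$ (least general). A list of lists is read as a formula in disjunctive normal form; for example $[[a,b],[c]]$ is read as $(a\wedge b)\vee c$. A feature left unspecified in a class imposes no constraint, i.e. has value $\top_f$. Semantic representation: for each feature $f$, fix a universal set $\mathbb{U}$ and an interpretation of each datum $a$ as a set $[\![a]\!]\subseteq\mathbb{U}$ (these may depend on $f$). The semantic representation $x^s\subseteq\mathbb{U}$ of a value $x$ is $$[[a_1,\dots,a_m],\dots,[b_1,\dots,b_n]]^s=([\![a_1]\!]\cap\cdots\cap[\![a_m]\!])\cup\cdots\cup([\![b_1]\!]\cap\cdots\cap[\![b_n]\!]),$$ with $\top_f^s=\mathbb{U}$ and $\bot_f^s=\emptyset$ (empty intersections are $\mathbb{U}$, empty unions are $\emptyset$). Values are identified when their semantic representations are equal, and two classes are equal iff they have equal semantic representation at every $f\in\mathcal{N}$.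 Operations: $C_1\wedge C_2$ and $C_1\vee C_2$ are the classes given, for every $f\in\mathcal{N}$, by $(C_1\wedge C_2)(f)=C_1(f)\wedge_f C_2(f)$ and $(C_1\vee C_2)(f)=C_1(f)\vee_f C_2(f)$. Here $C_1(f)\wedge_f C_2(f)$ is the value with semantic representation $C_1(f)^s\cap C_2(f)^s$, and $C_1(f)\vee_f C_2(f)$ is the value with semantic representation $C_1(f)^s\cup C_2(f)^s$. Such values exist as disjunctive normal forms up to semantic equality. The class $\top$ has $\top(f)=\top_f$ for all $f$, and the class $\bot$ has $\bot(f)=\bot_f$ for all $f$. -}

module Defs where

open import Algebra.Core using (Op₂)
open import Data.List.Base using (List; []; _∷_; _++_; map; foldr; cartesianProductWith)
open import Data.Product.Base using (_×_; _,_; proj₁; proj₂; Σ-syntax)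
open import Data.Sum.Base using (inj₁; inj₂)
open import Level using (Level; _⊔_)
open import Relation.Unary using (Pred; _≐_; _∩_; _∪_)
open import Relation.Unary.Polymorphic using (U; ∅)

data Feature : Set where
  top-symbol has-symbol : Feature

data Value {a : Level} (Datum : Set a) : Set a where
  dnf     : List (List Datum) → Value Datum
  ⊤ᵥ ⊥ᵥ   : Value Datum

-- A feature left unspecified in a class is represented by the value ⊤ᵥ.
Class : {a : Level} → Set a → Set a
Class Datum = Feature → Value Datum

-- Both the universal set and the interpretation may depend on the feature.
module Classes
  {a u ℓ : Level} (Datum : Set a)
  (𝕌 : Feature → Set u)
  (⟦_⟧ : {f : Feature} → Datum → Pred (𝕌 f) ℓ)
  where

  ⋂ˢ : {f : Feature} → List Datum → Pred (𝕌 f) ℓ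
  ⋂ˢ = foldr (λ d P → ⟦ d ⟧ ∩ P) U

  ⋃ˢ : {f : Feature} → List (List Datum) → Pred (𝕌 f) ℓ
  ⋃ˢ = foldr (λ ds P → ⋂ˢ ds ∪ P) ∅

  sem : (f : Feature) → Value Datum → Pred (𝕌 f) ℓ
  sem f (dnf dss) = ⋃ˢ dss
  sem f ⊤ᵥ        = U
  sem f ⊥ᵥ        = ∅

  infix 4 _≈_
  _≈_ : Class Datum → Class Datum → Set (u ⊔ ℓ)
  C₁ ≈ C₂ = (f : Feature) → sem f (C₁ f) ≐ sem f (C₂ f)

  private
    ⋂ˢ-++ : {f : Feature} (as bs : List Datum) →
            ⋂ˢ {f} (as ++ bs) ≐ ⋂ˢ as ∩ ⋂ˢ bs
    ⋂ˢ-++ []       bs = (λ q → _ , q) , proj₂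
    ⋂ˢ-++ (d ∷ as) bs with to , from ← ⋂ˢ-++ as bs =
      (λ (p , q) → (p , proj₁ (to q)) , proj₂ (to q)) ,
      (λ ((p , q) , r) → p , from (q , r))

    ⋃ˢ-++ : {f : Feature} (ass bss : List (List Datum)) →
            ⋃ˢ {f} (ass ++ bss) ≐ ⋃ˢ ass ∪ ⋃ˢ bss
    ⋃ˢ-++ []         bss = inj₂ , λ { (inj₂ q) → q }
    ⋃ˢ-++ (as ∷ ass) bss with to , from ← ⋃ˢ-++ ass bss =
      (λ { (inj₁ p) → inj₁ (inj₁ p)
         ; (inj₂ q) → case (to q) }) ,
      (λ { (inj₁ (inj₁ p)) → inj₁ p
         ; (inj₁ (inj₂ p)) → inj₂ (from (inj₁ p))
         ; (inj₂ q)        → inj₂ (from (inj₂ q)) })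
      where
      case : ∀ {x} → (⋃ˢ ass ∪ ⋃ˢ bss) x → (⋃ˢ (as ∷ ass) ∪ ⋃ˢ bss) x
      case (inj₁ p) = inj₁ (inj₂ p)
      case (inj₂ q) = inj₂ q

    ⋃ˢ-map : {f : Feature} (as : List Datum) (bss : List (List Datum)) →
             ⋃ˢ {f} (map (as ++_) bss) ≐ ⋂ˢ as ∩ ⋃ˢ bss
    ⋃ˢ-map as []         = (λ ()) , λ ()
    ⋃ˢ-map as (bs ∷ bss)
      with to₁ , from₁ ← ⋂ˢ-++ as bs | to₂ , from₂ ← ⋃ˢ-map as bss =
      (λ { (inj₁ p) → proj₁ (to₁ p) , inj₁ (proj₂ (to₁ p))
         ; (inj₂ q) → proj₁ (to₂ q) , inj₂ (proj₂ (to₂ q)) }) ,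
      (λ { (p , inj₁ q) → inj₁ (from₁ (p , q))
         ; (p , inj₂ q) → inj₂ (from₂ (p , q)) })

    ⋃ˢ-product : {f : Feature} (ass bss : List (List Datum)) →
                 ⋃ˢ {f} (cartesianProductWith _++_ ass bss) ≐ ⋃ˢ ass ∩ ⋃ˢ bss
    ⋃ˢ-product []         bss = (λ ()) , λ ()
    ⋃ˢ-product (as ∷ ass) bss
      with to₁ , from₁ ← ⋃ˢ-++ (map (as ++_) bss) (cartesianProductWith _++_ ass bss)
         | to₂ , from₂ ← ⋃ˢ-map as bss
         | to₃ , from₃ ← ⋃ˢ-product ass bss =
      (λ p → case (to₁ p)) ,
      (λ { (inj₁ p , q) → from₁ (inj₁ (from₂ (p , q)))
         ; (inj₂ p , q) → from₁ (inj₂ (from₃ (p , q))) })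
      where
      case : ∀ {x} →
             (⋃ˢ (map (as ++_) bss) ∪ ⋃ˢ (cartesianProductWith _++_ ass bss)) x →
             (⋃ˢ (as ∷ ass) ∩ ⋃ˢ bss) x
      case (inj₁ p) = inj₁ (proj₁ (to₂ p)) , proj₂ (to₂ p)
      case (inj₂ p) = inj₂ (proj₁ (to₃ p)) , proj₂ (to₃ p)

  -- The meet and join of two values are specified by their semantic
  -- representation, which determines them up to semantic equality; the
  -- disjunctive normal forms chosen below are therefore immaterial.

  meet : (f : Feature) (x y : Value Datum) →
         Σ[ z ∈ Value Datum ] (sem f z ≐ sem f x ∩ sem f y)
  meet f ⊤ᵥ        y         = y , (λ q → _ , q) , proj₂
  meet f ⊥ᵥ        y         = ⊥ᵥ , (λ ()) , λ ()
  meet f (dnf ass) ⊤ᵥ        = dnf ass , (λ p → p , _) , proj₁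
  meet f (dnf ass) ⊥ᵥ        = ⊥ᵥ , (λ ()) , λ ()
  meet f (dnf ass) (dnf bss) =
    dnf (cartesianProductWith _++_ ass bss) , ⋃ˢ-product ass bss

  join : (f : Feature) (x y : Value Datum) →
         Σ[ z ∈ Value Datum ] (sem f z ≐ sem f x ∪ sem f y)
  join f ⊤ᵥ        y         = ⊤ᵥ , inj₁ , _
  join f ⊥ᵥ        y         = y , inj₂ , λ { (inj₂ q) → q }
  join f (dnf ass) ⊤ᵥ        = ⊤ᵥ , inj₂ , _
  join f (dnf ass) ⊥ᵥ        = dnf ass , inj₁ , λ { (inj₁ p) → p }
  join f (dnf ass) (dnf bss) = dnf (ass ++ bss) , ⋃ˢ-++ ass bss

  infixr 7 _∧_
  infixr 6 _∨_

  _∧_ : Op₂ (Class Datum)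
  (C₁ ∧ C₂) f = proj₁ (meet f (C₁ f) (C₂ f))

  _∨_ : Op₂ (Class Datum)
  (C₁ ∨ C₂) f = proj₁ (join f (C₁ f) (C₂ f))

  ⊤ : Class Datum
  ⊤ f = ⊤ᵥ

  ⊥ : Class Datum
  ⊥ f = ⊥ᵥ

{-# OPTIONS --safe #-}

-- A class is determined, up to ≈, by the single subset { (f , x) ∣ x ∈ C(f)ˢ } of
-- Σ Feature 𝕌. This representation turns ∧ and ∨ into ∩ and ∪, so the
-- lattice laws are pulled back from those of the subsets of Σ Feature 𝕌.
module Submission where

open import Defs
open import Algebra.Lattice.Bundles using (RawLattice)
import Algebra.Lattice.Morphism.LatticeMonomorphism as LatticeMonomorphism
open import Algebra.Lattice.Morphism.Structures using (IsLatticeMonomorphism)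
open import Algebra.Lattice.Structures using (IsLattice)
open import Data.Product.Base using (_×_; _,_; proj₁; proj₂; Σ)
open import Level using (Level)
open import Relation.Unary using (Pred; _≐_; _∩_; _∪_)
open import Relation.Unary.Algebra using (∪-∩-isLattice; ∪-identityʳ; ∩-identityʳ)
open import Relation.Unary.Properties using (≐-trans)

module _ {a u ℓ : Level} (Datum : Set a) (𝕌 : Feature → Set u)
  (⟦_⟧ : {f : Feature} → Datum → Pred (𝕌 f) ℓ) where

  open Classes Datum 𝕌 ⟦_⟧

  semantics : Class Datum → Pred (Σ Feature 𝕌) ℓ
  semantics C (f , x) = sem f (C f) x

  classes : RawLattice _ _
  classes = record { Carrier = Class Datum ; _≈_ = _≈_ ; _∧_ = _∧_ ; _∨_ = _∨_ }

  subsets : RawLattice _ _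
  subsets = record { Carrier = Pred (Σ Feature 𝕌) ℓ ; _≈_ = _≐_ ; _∧_ = _∩_ ; _∨_ = _∪_ }

  semantics-isLatticeMonomorphism : IsLatticeMonomorphism classes subsets semantics
  semantics-isLatticeMonomorphism = record
    { isLatticeHomomorphism = record
      { isRelHomomorphism = record
        { cong = λ C≈D → (λ {(f , _)} → proj₁ (C≈D f)) , λ {(f , _)} → proj₂ (C≈D f) }
      -- The second component of `meet` or `join` is already the required `≐` at `f`, so no
      -- disjunctive normal form has to be inspected here.
      ; ∧-homo = λ C D →
          (λ {(f , _)} → proj₁ (proj₂ (meet f (C f) (D f)))) ,
          (λ {(f , _)} → proj₂ (proj₂ (meet f (C f) (D f))))
      ; ∨-homo = λ C D →
          (λ {(f , _)} → proj₁ (proj₂ (join f (C f) (D f)))) ,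
          (λ {(f , _)} → proj₂ (proj₂ (join f (C f) (D f))))
      }
    -- An inclusion over `Σ Feature 𝕌` is a family of inclusions, one per feature; this restricts it
    -- to the fibre over `f`, and `cong` above reassembles the fibres.
    ; injective = λ (to , from) f → (λ {x} → to {f , x}) , λ {x} → from {f , x}
    }

  -- Each law holds for the images under `semantics`, and injectivity reflects it back to classes.
  ∨-∧-isLattice : IsLattice _≈_ _∨_ _∧_
  ∨-∧-isLattice = LatticeMonomorphism.isLattice semantics-isLatticeMonomorphism
    (∪-∩-isLattice (Σ Feature 𝕌) ℓ)

  -- The bounds are not part of the raw lattices above, so their laws are checked feature by
  -- feature: `sem f ⊥ᵥ` reduces to the empty set, and below `sem f ⊤ᵥ` reduces to the whole of
  -- `𝕌 f`.
  ∨-identityʳ : (C : Class Datum) → C ∨ ⊥ ≈ C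
  ∨-identityʳ C f = ≐-trans (proj₂ (join f (C f) ⊥ᵥ)) (∪-identityʳ (sem f (C f)))

  ∧-identityʳ : (C : Class Datum) → C ∧ ⊤ ≈ C
  ∧-identityʳ C f = ≐-trans (proj₂ (meet f (C f) ⊤ᵥ)) (∩-identityʳ (sem f (C f)))

mainTheorem1 : {a u ℓ : Level} (Datum : Set a) (𝕌 : Feature → Set u)
    (⟦_⟧ : {f : Feature} → Datum → Pred (𝕌 f) ℓ) →
    let open Classes Datum 𝕌 ⟦_⟧ in
    IsLattice _≈_ _∨_ _∧_
    × ((C : Class Datum) → C ∨ ⊥ ≈ C)
    × ((C : Class Datum) → C ∧ ⊤ ≈ C)
mainTheorem1 Datum 𝕌 ⟦_⟧ =
  ∨-∧-isLattice Datum 𝕌 ⟦_⟧ , ∨-identityʳ Datum 𝕌 ⟦_⟧ , ∧-identityʳ Datum 𝕌 ⟦_⟧
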